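{- Let $B$ be a symmetric matrix over a field of characteristic $2$, with $\operatorname{epr}(B)=\ell_1\ell_2\cdots\ell_n$. If $\ell_k\ell_{k+1}=\mathtt{NA}$ or $\ell_k\ell_{k+1}=\mathtt{NS}$ for some $k$, then $k$ is odd and $\ell_j=\mathtt{N}$ for every odd $j$ (with $1\le j\le n$).
   Context: For an $n\times n$ symmetric matrix $B$ over a field $\mathbb{F}$, the enhanced principal rank characteristic sequence (epr-sequence) is $\operatorname{epr}(B)=\ell_1\ell_2\cdots\ell_n$, where $\ell_k=\mathtt{A}$ if all principal minors of $B$ of order $k$ are nonzero, $\ell_k=\mathtt{S}$ if some but not all principal minors of order $k$ are nonzero, and $\ell_k=\mathtt{N}$ if all principal minors of order $k$ are zero. -}

module Defs where

open import Algebra.Apartness.Bundles using (HeytingField; HeytingCommutativeRing)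
open import Algebra.Bundles using (CommutativeRing; Semiring)
import Algebra.Definitions.RawSemiring as RawSemiringDefinitions
open import Data.Fin.Base using (Fin; zero; suc; toℕ; punchIn)
open import Data.Fin.Subset using (Subset; inside; outside; ∣_∣)
open import Data.Nat.Base using (ℕ; zero; suc)
open import Data.Nat.Divisibility using (_∣_; _∤_)
open import Data.Product.Base using (_×_; ∃-syntax)
open import Data.Vec.Base using (Vec; lookup; []; _∷_)
open import Function.Base using (_∘_)
open import Function.Bundles using (_⇔_)
open import Level using (Level)
open import Relation.Binary.PropositionalEquality.Core using (_≡_)
open import Relation.Nullary.Negation.Core using (¬_)

private
  variable
    c ℓ ℓ₁ ℓ₂ : Level
    n : ℕ

Odd : ℕ → Set
Odd m = 2 ∤ m

-- The increasing enumeration of the elements of a subset.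
elements : (α : Subset n) → Fin ∣ α ∣ → Fin n
elements (outside ∷ α) i       = suc (elements α i)
elements (inside  ∷ α) zero    = zero
elements (inside  ∷ α) (suc i) = suc (elements α i)

fieldRing : HeytingField c ℓ₁ ℓ₂ → CommutativeRing c ℓ₁
fieldRing F = HeytingCommutativeRing.commutativeRing (HeytingField.heytingCommutativeRing F)

data Letter : Set where
  A S N : Letter

module _ (R : CommutativeRing c ℓ) where

  open CommutativeRing R using (Carrier; _≈_; _≉_; _*_; -_; 0#; 1#; semiring)
  open RawSemiringDefinitions (Semiring.rawSemiring semiring) using (sum; _^_) renaming (_×_ to _·_)

  -- p · 1# is the p-fold sum 1# + ⋯ + 1#; the condition says that the kernel
  -- of the canonical map from ℤ to R is generated by p.
  HasCharacteristic : ℕ → Set ℓ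
  HasCharacteristic p = ∀ m → (m · 1# ≈ 0#) ⇔ (p ∣ m)

  Matrix : ℕ → Set c
  Matrix n = Fin n → Fin n → Carrier

  Symmetric : Matrix n → Set ℓ
  Symmetric B = ∀ i j → B i j ≈ B j i

  -- Laplace expansion along the first row.
  det : Matrix n → Carrier
  det {zero}  B = 1#
  det {suc n} B =
    sum λ j → ((- 1#) ^ toℕ j * B zero j) * det λ r s → B (suc r) (punchIn j s)

  -- The minor of B on the rows and columns indexed by α; its order is ∣ α ∣.
  principalMinor : Matrix n → Subset n → Carrier
  principalMinor B α = det λ i j → B (elements α i) (elements α j)

  HasLetter : Matrix n → ℕ → Letter → Set ℓ
  HasLetter B k A = ∀ α → ∣ α ∣ ≡ k → principalMinor B α ≉ 0#
  HasLetter B k S = (∃[ α ] ∣ α ∣ ≡ k × principalMinor B α ≉ 0#)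
                  × ¬ (∀ α → ∣ α ∣ ≡ k → principalMinor B α ≉ 0#)
  HasLetter B k N = ∀ α → ∣ α ∣ ≡ k → principalMinor B α ≈ 0#

-- The 1-based position in the sequence of the entry indexed by i.
position : Fin n → ℕ
position i = suc (toℕ i)

-- epr(B) = ℓs.  This is a relation because computing the letters would require
-- equality in R to be decidable.  Since minors of each order 1, …, n exist, at
-- most one sequence is related to B, and exactly one if equality is decidable.
IsEpr : (R : CommutativeRing c ℓ) → Matrix R n → Vec Letter n → Set ℓ
IsEpr R B ℓs = ∀ i → HasLetter R B (position i) (lookup ℓs i)

{-# OPTIONS --safe #-}

-- In characteristic 2 the signs disappear from the determinant, and for a
-- symmetric matrix the terms of the expansion along a row and the corresponding
-- column cancel in pairs, leaving
--   det B[i ∪ α] = bᵢᵢ det B[α] + Σ_{j ∈ α} bᵢⱼ² det B[α ∖ j].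
-- Suppose all principal minors of order k vanish, and let p ∪ α have order k + 1.
-- Two applications of the expansion give, for every index i,
--   bᵢᵢ det B[p ∪ α] = Σ_{q ≠ j in α} bₚq² bᵢⱼ² det B[α ∖ {q, j}],
-- which is symmetric in i and p, and is zero for i = p since its terms then
-- cancel in pairs.  So if det B[p ∪ α] ≠ 0, then bₚₚ = 0, and hence bᵢᵢ = 0 for
-- all i.  With a zero diagonal the expansion kills every principal minor of odd order.

module Submission where

open import Defs
open import Algebra.Apartness.Bundles using (HeytingField)
open import Algebra.Bundles using (CommutativeRing; Semiring)
import Algebra.Definitions.RawSemiring as RawSemiringDefinitions
import Algebra.Properties.CommutativeSemigroup as CommutativeSemigroupProperties
import Algebra.Properties.Ring as RingProperties
open import Data.Empty using (⊥-elim)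
open import Data.Fin.Base using (Fin; zero; suc; toℕ; punchIn)
open import Data.Fin.Properties using (toℕ<n)
open import Data.Fin.Subset using (Subset; inside; outside; ∣_∣; ⊥)
open import Data.Fin.Subset.Properties using (∣⊥∣≡0)
open import Data.List.Base using (List; []; _∷_; length; map; tabulate)
open import Data.List.Properties using (map-tabulate; length-tabulate)
open import Data.List.Relation.Binary.Permutation.Propositional
  using (_↭_; refl; prep; swap; trans; ↭-reflexive)
open import Data.List.Relation.Binary.Permutation.Propositional.Properties
  using (↭-length; map⁺)
open import Data.Nat.Base using (ℕ; zero; suc; _≤_; z≤n; s≤s)
open import Data.Nat.Divisibility using (_∣_; ∣1⇒≡1; ∣m+n∣m⇒∣n; ∣m∣n⇒∣m+n; ∣-refl; _∣0)
import Data.Nat.Properties as ℕ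
open import Data.Product.Base using (_×_; _,_; proj₁; proj₂; ∃-syntax)
open import Data.Sum.Base using (_⊎_; inj₁; inj₂)
open import Data.Vec.Base using (Vec; lookup; []; _∷_)
open import Function.Base using (_∘_)
open import Function.Bundles using (Equivalence)
open import Level using (Level; _⊔_)
open import Relation.Binary.PropositionalEquality.Core as ≡ using (_≡_; cong; subst)
import Relation.Binary.Reasoning.Setoid as SetoidReasoning

private
  variable
    c ℓ : Level
    m n : ℕ
    I : Set

-- Subsets as lists of indices, up to permutation

members : Subset n → List (Fin n)
members α = tabulate (elements α)

members-outside : (α : Subset n) → members (outside ∷ α) ≡ map suc (members α)
members-outside α = ≡.sym (map-tabulate (elements α) suc)

members-inside : (α : Subset n) → members (inside ∷ α) ≡ zero ∷ map suc (members α)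
members-inside α = cong (zero ∷_) (members-outside α)

-- The first case is that `i` lies in `α`, and `β` is then `α` without `i`; in the second, `i` is
-- new and `β` is `α` with `i` added.
insert : (i : Fin n) (α : Subset n) →
  (∃[ β ] members α ↭ i ∷ members β) ⊎ (∃[ β ] i ∷ members α ↭ members β)
insert zero (inside ∷ α) = inj₁ (outside ∷ α , refl)
insert zero (outside ∷ α) = inj₂ (inside ∷ α , refl)
insert (suc i) (outside ∷ α) with insert i α
... | inj₁ (β , p) = inj₁ (outside ∷ β ,
  trans (↭-reflexive (members-outside α)) (trans (map⁺ suc p)
    (prep _ (↭-reflexive (≡.sym (members-outside β))))))
... | inj₂ (β , p) = inj₂ (outside ∷ β ,
  trans (prep _ (↭-reflexive (members-outside α))) (trans (map⁺ suc p)
    (↭-reflexive (≡.sym (members-outside β)))))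
insert (suc i) (inside ∷ α) with insert i α
... | inj₁ (β , p) = inj₁ (inside ∷ β ,
  trans (↭-reflexive (members-inside α)) (trans (prep zero (map⁺ suc p))
    (swap zero (suc i) (↭-reflexive (≡.sym (members-outside β))))))
... | inj₂ (β , p) = inj₂ (inside ∷ β ,
  trans (swap (suc i) zero (↭-reflexive (members-outside α)))
    (prep zero (trans (map⁺ suc p) (↭-reflexive (≡.sym (members-outside β))))))

-- Carries the vanishing of principal minors over to minors indexed by arbitrary lists: a repeated
-- index makes the minor zero anyway, and any other list enumerates a subset.
duplicate-or-subset : (l : List (Fin n)) →
  (∃[ i ] ∃[ l′ ] l ↭ i ∷ i ∷ l′) ⊎ (∃[ α ] l ↭ members α)
duplicate-or-subset {n} [] = inj₂ (⊥ , ↭-reflexive (empty n))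
  where
  empty : ∀ n → [] ≡ members (⊥ {n})
  empty zero = ≡.refl
  empty (suc n) = ≡.trans (cong (map suc) (empty n)) (≡.sym (members-outside ⊥))
duplicate-or-subset (x ∷ l) with duplicate-or-subset l
... | inj₁ (i , l′ , p) = inj₁ (i , x ∷ l′ ,
  trans (prep x p) (trans (swap x i refl) (prep i (swap x i refl))))
... | inj₂ (α , p) with insert x α
...   | inj₁ (β , q) = inj₁ (x , members β , prep x (trans p q))
...   | inj₂ (β , q) = inj₂ (β , trans (prep x p) q)

-- Ensures that the letter `A` is never vacuous at an order up to `n`.
subsetOfSize : m ≤ n → ∃[ α ] ∣_∣ {n} α ≡ m
subsetOfSize {n = n} z≤n = ⊥ , ∣⊥∣≡0 n
subsetOfSize (s≤s m≤n) with subsetOfSize m≤n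
... | α , eq = inside ∷ α , cong suc eq

-- Sums over the entries of a list in characteristic 2

SelfCancelling : CommutativeRing c ℓ → Set (c ⊔ ℓ)
SelfCancelling R = ∀ x → x + x ≈ 0#
  where open CommutativeRing R

module Characteristic2 (R : CommutativeRing c ℓ) (x+x≈0 : SelfCancelling R) where

  open CommutativeRing R hiding (refl; sym; trans; zero)
  open CommutativeRing R using () renaming (refl to ≈-refl; sym to ≈-sym; trans to ≈-trans)
  open RawSemiringDefinitions (Semiring.rawSemiring semiring) using (sum; _^_)
  module + = CommutativeSemigroupProperties +-commutativeSemigroup
  module * = CommutativeSemigroupProperties *-commutativeSemigroup
  open SetoidReasoning setoid

  x+y≈0⇒x≈y : ∀ {x y} → x + y ≈ 0# → x ≈ y
  x+y≈0⇒x≈y {x} {y} x+y≈0 = begin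
    x            ≈⟨ +-identityʳ x ⟨
    x + 0#       ≈⟨ +-congˡ (x+x≈0 y) ⟨
    x + (y + y)  ≈⟨ +-assoc x y y ⟨
    (x + y) + y  ≈⟨ +-congʳ x+y≈0 ⟩
    0# + y       ≈⟨ +-identityˡ y ⟩
    y            ∎

  -1^ : ∀ m → (- 1#) ^ m ≈ 1#
  -1^ zero = ≈-refl
  -1^ (suc m) = ≈-trans (*-cong (x+y≈0⇒x≈y (-‿inverseˡ 1#)) (-1^ m)) (*-identityˡ 1#)

  -- The sum over all ways of removing an entry x from l, leaving the list L.
  ∑ : List I → (I → List I → Carrier) → Carrier
  ∑ [] g = 0#
  ∑ (x ∷ l) g = g x l + ∑ l λ y L → g y (x ∷ L)

  syntax ∑ l (λ x L → e) = ∑[ x , L ← l ] e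

  -- The equation on lengths makes facts about lists of a given length, and inductions on length,
  -- available under the sum.
  ∑-cong : ∀ (l : List I) {g h} →
    (∀ x L → suc (length L) ≡ length l → g x L ≈ h x L) → ∑ l g ≈ ∑ l h
  ∑-cong [] g≈h = ≈-refl
  ∑-cong (x ∷ l) g≈h =
    +-cong (g≈h x l ≡.refl) (∑-cong l λ y L eq → g≈h y (x ∷ L) (cong suc eq))

  ∑-0 : ∀ (l : List I) → ∑[ x , L ← l ] 0# ≈ 0#
  ∑-0 [] = ≈-refl
  ∑-0 (x ∷ l) = ≈-trans (+-identityˡ _) (∑-0 l)

  ∑-+ : ∀ (l : List I) g h → ∑[ x , L ← l ] (g x L + h x L) ≈ ∑ l g + ∑ l h
  ∑-+ [] g h = ≈-sym (+-identityˡ 0#)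
  ∑-+ (x ∷ l) g h = ≈-trans (+-congˡ (∑-+ l _ _)) (+.interchange _ _ _ _)

  ∑-* : ∀ (l : List I) a g → a * ∑ l g ≈ ∑[ x , L ← l ] (a * g x L)
  ∑-* [] a g = zeroʳ a
  ∑-* (x ∷ l) a g = ≈-trans (distribˡ _ _ _) (+-congˡ (∑-* l a _))

  ∑-comm : ∀ (l l′ : List I) (h : I → List I → I → List I → Carrier) →
    ∑[ x , L ← l ] ∑[ y , L′ ← l′ ] h x L y L′ ≈ ∑[ y , L′ ← l′ ] ∑[ x , L ← l ] h x L y L′
  ∑-comm [] l′ h = ≈-sym (∑-0 l′)
  ∑-comm (x ∷ l) l′ h = ≈-trans (+-congˡ (∑-comm l l′ _)) (≈-sym (∑-+ l′ _ _))

  -- The terms at two different positions come in equal pairs, which cancel in characteristic 2;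
  -- only the diagonal survives.
  ∑-symmetric : ∀ (l : List I) (h : I → List I → I → List I → Carrier) →
    (∀ x L y L′ → suc (length L) ≡ length l → suc (length L′) ≡ length l →
      h x L y L′ ≈ h y L′ x L) →
    ∑[ x , L ← l ] ∑[ y , L′ ← l ] h x L y L′ ≈ ∑[ x , L ← l ] h x L x L
  ∑-symmetric [] h h-sym = ≈-refl
  ∑-symmetric (x ∷ l) h h-sym = begin
    (h x l x l + a) + ∑[ y , L ← l ] (h y (x ∷ L) x l + _)  ≈⟨ +-congˡ (∑-+ l _ _) ⟩
    (h x l x l + a) + (b + d)                               ≈⟨ +-assoc _ _ _ ⟩
    h x l x l + (a + (b + d))                               ≈⟨ +-congˡ (+-assoc _ _ _) ⟨
    h x l x l + ((a + b) + d)                               ≈⟨ +-congˡ (+-congʳ (+-congˡ b≈a)) ⟩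
    h x l x l + ((a + a) + d)                               ≈⟨ +-congˡ (+-congʳ (x+x≈0 a)) ⟩
    h x l x l + (0# + d)                                    ≈⟨ +-congˡ (+-identityˡ d) ⟩
    h x l x l + d                                           ≈⟨ +-congˡ (∑-symmetric l _ λ _ _ _ _ p q →
                                                                 h-sym _ _ _ _ (cong suc p) (cong suc q)) ⟩
    h x l x l + ∑[ y , L ← l ] h y (x ∷ L) y (x ∷ L)        ∎
    where
    a = ∑[ y , L ← l ] h x l y (x ∷ L)
    b = ∑[ y , L ← l ] h y (x ∷ L) x l
    d = ∑[ y , L ← l ] ∑[ z , L′ ← l ] h y (x ∷ L) z (x ∷ L′)
    b≈a : b ≈ a
    b≈a = ∑-cong l λ y L eq → h-sym _ _ _ _ (cong suc eq) ≡.refl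

  -- Removing two entries leaves the same list whichever of them goes first.
  ∑∑-comm : ∀ (l : List I) (h : I → I → List I → Carrier) →
    ∑[ x , L ← l ] ∑[ y , L′ ← L ] h x y L′ ≈ ∑[ x , L ← l ] ∑[ y , L′ ← L ] h y x L′
  ∑∑-comm [] h = ≈-refl
  ∑∑-comm (x ∷ l) h = begin
    a + ∑[ y , L ← l ] (h y x L + _)  ≈⟨ +-congˡ (∑-+ l _ _) ⟩
    a + (b + _)                       ≈⟨ +.x∙yz≈y∙xz _ _ _ ⟩
    b + (a + _)                       ≈⟨ +-congˡ (+-congˡ (∑∑-comm l _)) ⟩
    b + (a + _)                       ≈⟨ +-congˡ (∑-+ l _ _) ⟨
    b + ∑[ y , L ← l ] (h x y L + _)  ∎
    where
    a = ∑[ y , L ← l ] h x y L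
    b = ∑[ y , L ← l ] h y x L

  -- Each unordered pair of positions contributes two equal terms, and here no diagonal is left
  -- over.
  ∑∑-symmetric : ∀ (l : List I) (h : I → I → List I → Carrier) →
    (∀ x y L → h x y L ≈ h y x L) → ∑[ x , L ← l ] ∑[ y , L′ ← L ] h x y L′ ≈ 0#
  ∑∑-symmetric [] h h-sym = ≈-refl
  ∑∑-symmetric (x ∷ l) h h-sym = begin
    a + ∑[ y , L ← l ] (h y x L + _)  ≈⟨ +-congˡ (∑-+ l _ _) ⟩
    a + (b + d)                       ≈⟨ +-cong (∑-cong l λ y L _ → h-sym x y L)
                                           (+-congˡ (∑∑-symmetric l _ λ y z L → h-sym y z (x ∷ L))) ⟩
    b + (b + 0#)                      ≈⟨ +-congˡ (+-identityʳ b) ⟩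
    b + b                             ≈⟨ x+x≈0 b ⟩
    0#                                ∎
    where
    a = ∑[ y , L ← l ] h x y L
    b = ∑[ y , L ← l ] h y x L
    d = ∑[ y , L ← l ] ∑[ z , L′ ← L ] h y z (x ∷ L′)

  ∑-↭ : ∀ {l l′ : List I} (g : I → List I → Carrier) →
    (∀ x {L L′} → suc (length L) ≡ length l → L ↭ L′ → g x L ≈ g x L′) →
    l ↭ l′ → ∑ l g ≈ ∑ l′ g
  ∑-↭ g g-resp refl = ≈-refl
  ∑-↭ g g-resp (prep x p) = +-cong (g-resp x ≡.refl p)
    (∑-↭ _ (λ y eq q → g-resp y (cong suc eq) (prep x q)) p)
  ∑-↭ g g-resp (swap {xs = l} {ys = l′} x y p) = begin
    g x (y ∷ l) + (g y (x ∷ l) + _)    ≈⟨ +.x∙yz≈y∙xz _ _ _ ⟩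
    g y (x ∷ l) + (g x (y ∷ l) + _)    ≈⟨ +-cong (g-resp y ≡.refl (prep x p))
                                            (+-cong (g-resp x ≡.refl (prep y p))
                                              (≈-trans
                                                (∑-cong l λ z L eq →
                                                  g-resp z (cong (λ m → suc (suc m)) eq) (swap x y refl))
                                                (∑-↭ _ (λ z eq q →
                                                  g-resp z (cong (λ m → suc (suc m)) eq) (prep y (prep x q))) p))) ⟩
    g y (x ∷ l′) + (g x (y ∷ l′) + _)  ∎
  ∑-↭ g g-resp (trans p q) = ≈-trans (∑-↭ g g-resp p)
    (∑-↭ g (λ x eq → g-resp x (≡.trans eq (≡.sym (↭-length p)))) q)

  -- Matches the column deletion of the Laplace expansion with the removal of a list entry:
  -- `tabulate (γ ∘ punchIn j)` is `tabulate γ` without its entry at `j`.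
  sum-punchIn : ∀ {n} (γ : Fin (suc n) → I) (g : I → List I → Carrier)
    (t : Fin (suc n) → Carrier) → (∀ j → t j ≈ g (γ j) (tabulate (γ ∘ punchIn j))) →
    sum t ≈ ∑ (tabulate γ) g
  sum-punchIn {n = zero} γ g t t≈g = +-congʳ (t≈g zero)
  sum-punchIn {n = suc n} γ g t t≈g =
    +-cong (t≈g zero) (sum-punchIn (γ ∘ suc) (λ x L → g x (γ zero ∷ L)) (t ∘ suc) (t≈g ∘ suc))

  -- The determinant as a permanent

  module _ (B : I → I → Carrier) where

    -- Meaningful only for lists of equal length.
    permanent : List I → List I → Carrier
    permanent [] l = 1#
    permanent (r ∷ rs) l = ∑[ s , L ← l ] (B r s * permanent rs L)

    det≈permanent : ∀ {n} (ρ γ : Fin n → I) →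
      det R (λ i j → B (ρ i) (γ j)) ≈ permanent (tabulate ρ) (tabulate γ)
    det≈permanent {zero} ρ γ = ≈-refl
    det≈permanent {suc n} ρ γ = sum-punchIn γ (λ s L → B (ρ zero) s * permanent (tabulate (ρ ∘ suc)) L) _ λ j →
      *-cong (≈-trans (*-congʳ (-1^ (toℕ j))) (*-identityˡ _))
             (det≈permanent (ρ ∘ suc) (γ ∘ punchIn j))

  -- Minors of a symmetric matrix, indexed by lists

  module SymmetricMatrix (B : I → I → Carrier) (B-sym : ∀ i j → B i j ≈ B j i) where

    per = permanent B

    -- Invariance under transposition. Both sides are expanded along the first row and the first
    -- column, and the two double sums agree by exchange of summation. The bound `n` drives the
    -- induction, since the lists in the recursive calls are not sublists in the structural sense.
    per-comm-≤ : ∀ n rs cs → length rs ≤ n → length rs ≡ length cs → per rs cs ≈ per cs rs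
    per-comm-≤ n [] [] _ _ = ≈-refl
    per-comm-≤ (suc n) (r ∷ rs) (s ∷ cs) (s≤s rs≤n) eq = begin
      B r s * per rs cs + ∑[ y , L ← cs ] (B r y * per rs (s ∷ L))
        ≈⟨ +-cong (*-cong (B-sym r s) (per-comm-≤ n rs cs rs≤n eq′))
             (∑-cong cs λ y L p → ≈-trans
               (*-congˡ (per-comm-≤ n rs (s ∷ L) rs≤n (≡.trans eq′ (≡.sym p)))) (∑-* rs _ _)) ⟩
      B s r * per cs rs + ∑[ y , L ← cs ] ∑[ x , K ← rs ] (B r y * (B s x * per L K))
        ≈⟨ +-congˡ (∑-comm cs rs _) ⟩
      B s r * per cs rs + ∑[ x , K ← rs ] ∑[ y , L ← cs ] (B r y * (B s x * per L K))
        ≈⟨ +-congˡ (∑-cong rs λ x K p → ∑-cong cs λ y L q → ≈-trans (*.x∙yz≈y∙xz _ _ _)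
             (*-congˡ (*-congˡ (≈-sym (per-comm-≤ n K L
               (ℕ.≤-trans (ℕ.n≤1+n _) (ℕ.≤-trans (ℕ.≤-reflexive p) rs≤n))
               (ℕ.suc-injective (≡.trans p (≡.trans eq′ (≡.sym q))))))))) ⟩
      B s r * per cs rs + ∑[ x , K ← rs ] ∑[ y , L ← cs ] (B s x * (B r y * per K L))
        ≈⟨ +-congˡ (∑-cong rs λ x K p → ≈-trans (≈-sym (∑-* cs _ _))
             (*-congˡ (≈-sym (per-comm-≤ n cs (r ∷ K) (ℕ.≤-trans (ℕ.≤-reflexive (≡.sym eq′)) rs≤n)
               (≡.trans (≡.sym eq′) (≡.sym p)))))) ⟩
      B s r * per cs rs + ∑[ x , K ← rs ] (B s x * per cs (r ∷ K))
        ∎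
      where eq′ = ℕ.suc-injective eq

    per-comm : ∀ rs cs → length rs ≡ length cs → per rs cs ≈ per cs rs
    per-comm rs cs = per-comm-≤ (length rs) rs cs ℕ.≤-refl

    -- Repeated indices are allowed, so any index can be put in front of any list.
    minor : List I → Carrier
    minor l = per l l

    -- The part of the expansion of minor (i ∷ l) that avoids the diagonal entry B i i.
    offDiagonal : I → List I → Carrier
    offDiagonal i l = ∑[ j , L ← l ] (B i j * B i j * minor L)

    -- After transposing, row `i` can be expanded a second time. The resulting double sum over `j`
    -- and `j′` is symmetric, so only the terms with equal positions remain, and these carry
    -- squares.
    minor-expansion : ∀ i l → minor (i ∷ l) ≈ B i i * minor l + offDiagonal i l
    minor-expansion i l = +-congˡ (begin
      ∑[ j , L ← l ] (B i j * per l (i ∷ L))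
        ≈⟨ ∑-cong l (λ j L p → ≈-trans (*-congˡ (per-comm l (i ∷ L) (≡.sym p))) (∑-* l _ _)) ⟩
      ∑[ j , L ← l ] ∑[ j′ , L′ ← l ] (B i j * (B i j′ * per L L′))
        ≈⟨ ∑-symmetric l _ (λ j L j′ L′ p q → ≈-trans (*.x∙yz≈y∙xz _ _ _)
             (*-congˡ (*-congˡ (per-comm L L′ (ℕ.suc-injective (≡.trans p (≡.sym q))))))) ⟩
      ∑[ j , L ← l ] (B i j * (B i j * minor L))
        ≈⟨ ∑-cong l (λ _ _ _ → ≈-sym (*-assoc _ _ _)) ⟩
      offDiagonal i l ∎)

    offDiagonal² : I → I → List I → Carrier
    offDiagonal² i j l =
      ∑[ x , L ← l ] ∑[ y , L′ ← L ] (B i x * B i x * (B j y * B j y * minor L′))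

    offDiagonal²-comm : ∀ i j l → offDiagonal² i j l ≈ offDiagonal² j i l
    offDiagonal²-comm i j l = ≈-trans
      (∑∑-comm l (λ x y L → B i x * B i x * (B j y * B j y * minor L)))
      (∑-cong l λ _ L _ → ∑-cong L λ _ _ _ → *.x∙yz≈y∙xz _ _ _)

    offDiagonal²-diagonal : ∀ i l → offDiagonal² i i l ≈ 0#
    offDiagonal²-diagonal i l = ∑∑-symmetric l _ λ _ _ _ → *.x∙yz≈y∙xz _ _ _

    -- Expands along `i`, then along `j` wherever `j` is still present. The terms are grouped so
    -- that each bracket is visibly symmetric in `i` and `j`.
    minor-expansion² : ∀ i j l → minor (i ∷ j ∷ l) ≈
      (B i i * (B j j * minor l) + B i j * B i j * minor l) +
      ((B i i * offDiagonal j l + B j j * offDiagonal i l) + offDiagonal² i j l)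
    minor-expansion² i j l = begin
      minor (i ∷ j ∷ l)
        ≈⟨ minor-expansion i (j ∷ l) ⟩
      B i i * minor (j ∷ l) + (u + ∑[ x , L ← l ] (B i x * B i x * minor (j ∷ L)))
        ≈⟨ +-cong (≈-trans (*-congˡ (minor-expansion j l)) (distribˡ _ _ _)) (+-congˡ rest) ⟩
      (B i i * (B j j * minor l) + v) + (u + (w + z))
        ≈⟨ +.interchange _ _ _ _ ⟩
      (B i i * (B j j * minor l) + u) + (v + (w + z))
        ≈⟨ +-congˡ (+-assoc _ _ _) ⟨
      (B i i * (B j j * minor l) + u) + ((v + w) + z) ∎
      where
      u = B i j * B i j * minor l
      v = B i i * offDiagonal j l
      w = B j j * offDiagonal i l
      z = offDiagonal² i j l
      rest : ∑[ x , L ← l ] (B i x * B i x * minor (j ∷ L)) ≈ w + z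
      rest = begin
        ∑[ x , L ← l ] (B i x * B i x * minor (j ∷ L))
          ≈⟨ ∑-cong l (λ x L _ → ≈-trans (*-congˡ (minor-expansion j L)) (≈-trans (distribˡ _ _ _)
               (+-cong (*.x∙yz≈y∙xz _ _ _) (∑-* L _ _)))) ⟩
        ∑[ x , L ← l ] (B j j * (B i x * B i x * minor L) + _)
          ≈⟨ ∑-+ l _ _ ⟩
        ∑[ x , L ← l ] (B j j * (B i x * B i x * minor L)) + z
          ≈⟨ +-congʳ (∑-* l _ _) ⟨
        w + z ∎

    minor-swap : ∀ i j l → minor (i ∷ j ∷ l) ≈ minor (j ∷ i ∷ l)
    minor-swap i j l = begin
      minor (i ∷ j ∷ l)
        ≈⟨ minor-expansion² i j l ⟩
      _ ≈⟨ +-cong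
             (+-cong (*.x∙yz≈y∙xz _ _ _) (*-congʳ (*-cong (B-sym i j) (B-sym i j))))
             (+-cong (+-comm _ _) (offDiagonal²-comm i j l)) ⟩
      _ ≈⟨ minor-expansion² j i l ⟨
      minor (j ∷ i ∷ l) ∎

    -- For equal indices each of the first two brackets of the double expansion adds a term to
    -- itself, and `offDiagonal²` vanishes by pairing.
    minor-duplicate : ∀ i l → minor (i ∷ i ∷ l) ≈ 0#
    minor-duplicate i l = begin
      minor (i ∷ i ∷ l)
        ≈⟨ minor-expansion² i i l ⟩
      _ ≈⟨ +-cong
             (≈-trans (+-congʳ (≈-sym (*-assoc _ _ _))) (x+x≈0 _))
             (+-cong (x+x≈0 _) (offDiagonal²-diagonal i l)) ⟩
      0# + (0# + 0#)
        ≈⟨ ≈-trans (+-identityˡ _) (+-identityˡ _) ⟩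
      0# ∎

    mutual

      -- Under a common head, expansion along it reduces to shorter lists, for which `n` decreases;
      -- a swap at the front is `minor-swap`. Transitivity keeps `n` and descends on the derivation.
      minor-↭-≤ : ∀ n {l l′} → length l ≤ n → l ↭ l′ → minor l ≈ minor l′
      minor-↭-≤ n l≤n refl = ≈-refl
      minor-↭-≤ (suc n) (s≤s l≤n) (prep x p) = minor-prep-≤ n x l≤n p
      minor-↭-≤ (suc n) (s≤s l≤n) (swap {xs = l} x y p) =
        ≈-trans (minor-swap x y l) (minor-prep-≤ n y l≤n (prep x p))
      minor-↭-≤ n l≤n (trans p q) =
        ≈-trans (minor-↭-≤ n l≤n p) (minor-↭-≤ n (subst (_≤ n) (↭-length p) l≤n) q)

      minor-prep-≤ : ∀ n {l l′} x → length l ≤ n → l ↭ l′ → minor (x ∷ l) ≈ minor (x ∷ l′)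
      minor-prep-≤ n {l} {l′} x l≤n p = begin
        minor (x ∷ l)
          ≈⟨ minor-expansion x l ⟩
        B x x * minor l + offDiagonal x l
          ≈⟨ +-cong (*-congˡ (minor-↭-≤ n l≤n p))
               (∑-↭ _ (λ y eq q → *-congˡ (minor-↭-≤ n
                 (ℕ.≤-trans (ℕ.n≤1+n _) (ℕ.≤-trans (ℕ.≤-reflexive eq) l≤n)) q)) p) ⟩
        B x x * minor l′ + offDiagonal x l′
          ≈⟨ minor-expansion x l′ ⟨
        minor (x ∷ l′) ∎

    minor-↭ : ∀ {l l′} → l ↭ l′ → minor l ≈ minor l′
    minor-↭ = minor-↭-≤ _ ℕ.≤-refl

    -- Consequences of the vanishing of all minors of order k

    module _ {k} (minors≈0 : ∀ l → length l ≡ k → minor l ≈ 0#) where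

      diagonal*minor : ∀ i p l → length l ≡ k → B i i * minor (p ∷ l) ≈ offDiagonal² p i l
      diagonal*minor i p l l≡k = begin
        B i i * minor (p ∷ l)
          ≈⟨ *-congˡ (minor-expansion p l) ⟩
        B i i * (B p p * minor l + offDiagonal p l)
          ≈⟨ *-congˡ (≈-trans (+-congʳ (≈-trans (*-congˡ (minors≈0 l l≡k)) (zeroʳ _)))
               (+-identityˡ _)) ⟩
        B i i * offDiagonal p l
          ≈⟨ ∑-* l _ _ ⟩
        ∑[ x , L ← l ] (B i i * (B p x * B p x * minor L))
          -- `i ∷ L` again has length `k`, so its minor vanishes, and its expansion turns
          -- `B i i * minor L` into `offDiagonal i L`.
          ≈⟨ ∑-cong l (λ x L eq → ≈-trans (*.x∙yz≈y∙xz _ _ _)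
               (*-congˡ (x+y≈0⇒x≈y (≈-trans (≈-sym (minor-expansion i L))
                 (minors≈0 (i ∷ L) (≡.trans eq l≡k)))))) ⟩
        ∑[ x , L ← l ] (B p x * B p x * offDiagonal i L)
          ≈⟨ ∑-cong l (λ _ L _ → ∑-* L _ _) ⟩
        offDiagonal² p i l ∎

      diagonal*minor-self : ∀ p l → length l ≡ k → B p p * minor (p ∷ l) ≈ 0#
      diagonal*minor-self p l l≡k =
        ≈-trans (diagonal*minor p p l l≡k) (offDiagonal²-diagonal p l)

      diagonal*minor-comm : ∀ i p l → length l ≡ k →
        B i i * minor (p ∷ l) ≈ B p p * minor (i ∷ l)
      diagonal*minor-comm i p l l≡k = begin
        B i i * minor (p ∷ l)  ≈⟨ diagonal*minor i p l l≡k ⟩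
        offDiagonal² p i l     ≈⟨ offDiagonal²-comm p i l ⟩
        offDiagonal² i p l     ≈⟨ diagonal*minor p i l l≡k ⟨
        B p p * minor (i ∷ l)  ∎

    -- Minors of odd order under a zero diagonal

    module _ (diagonal≈0 : ∀ i → B i i ≈ 0#) where

      -- Only `offDiagonal` survives in the expansion, and it removes two indices at a time. The
      -- length stays odd, so the empty list, whose minor is `1#`, is never reached.
      odd-minor≈0 : ∀ l → Odd (length l) → minor l ≈ 0#
      odd-minor≈0 l = odd-minor≈0-≤ (length l) l ℕ.≤-refl
        where
        odd-minor≈0-≤ : ∀ n l → length l ≤ n → Odd (length l) → minor l ≈ 0#
        odd-minor≈0-≤ n [] _ odd = ⊥-elim (odd (2 ∣0))
        odd-minor≈0-≤ (suc n) (i ∷ l) (s≤s l≤n) odd = begin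
          minor (i ∷ l)
            ≈⟨ minor-expansion i l ⟩
          B i i * minor l + offDiagonal i l
            ≈⟨ +-cong (≈-trans (*-congʳ (diagonal≈0 i)) (zeroˡ _))
                 (∑-cong l λ x L eq → ≈-trans (*-congˡ (odd-minor≈0-≤ n L
                   (ℕ.≤-trans (ℕ.n≤1+n _) (ℕ.≤-trans (ℕ.≤-reflexive eq) l≤n))
                   λ 2∣L → odd (subst (2 ∣_) (cong suc eq) (∣m∣n⇒∣m+n ∣-refl 2∣L))))
                   (zeroʳ _)) ⟩
          0# + ∑[ x , L ← l ] 0#
            ≈⟨ ≈-trans (+-identityˡ _) (∑-0 l) ⟩
          0# ∎

  -- From lists back to principal minors

  module _ {n} (B : Matrix R n) (B-sym : Symmetric R B) where

    open SymmetricMatrix B B-sym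

    principalMinor≈minor : ∀ α → principalMinor R B α ≈ minor (members α)
    principalMinor≈minor α = det≈permanent B (elements α) (elements α)

    minors-vanish : ∀ {k} → HasLetter R B k N → ∀ l → length l ≡ k → minor l ≈ 0#
    minors-vanish letterN l l≡k with duplicate-or-subset l
    ... | inj₁ (i , l′ , p) = ≈-trans (minor-↭ p) (minor-duplicate i l′)
    ... | inj₂ (α , p) = begin
      minor l               ≈⟨ minor-↭ p ⟩
      minor (members α)     ≈⟨ principalMinor≈minor α ⟨
      principalMinor R B α  ≈⟨ letterN α (≡.trans (≡.sym (length-tabulate (elements α)))
                                 (≡.trans (≡.sym (↭-length p)) l≡k)) ⟩
      0#                    ∎

    odd-principalMinor≈0 : (∀ i → B i i ≈ 0#) → ∀ α → Odd ∣ α ∣ → principalMinor R B α ≈ 0#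
    odd-principalMinor≈0 diagonal≈0 α odd = ≈-trans (principalMinor≈minor α)
      (odd-minor≈0 diagonal≈0 (members α)
        (subst Odd (≡.sym (length-tabulate (elements α))) odd))

-- Fields of characteristic 2: the diagonal and the letters

module Field {c ℓ₁ ℓ₂} (F : HeytingField c ℓ₁ ℓ₂) (char2 : HasCharacteristic (fieldRing F) 2) where

  R = fieldRing F
  open HeytingField F using (_#_; tight; #⇒invertible)
  open CommutativeRing R hiding (refl; sym; trans; zero)
  open SetoidReasoning setoid

  x+x≈0 : ∀ x → x + x ≈ 0#
  x+x≈0 x = begin
    x + x                ≈⟨ +-cong (*-identityˡ x) (*-identityˡ x) ⟨
    1# * x + 1# * x      ≈⟨ distribʳ x 1# 1# ⟨
    (1# + 1#) * x        ≈⟨ *-congʳ (+-congˡ (+-identityʳ 1#)) ⟨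
    -- This first factor is what `2 · 1#` unfolds to.
    (1# + (1# + 0#)) * x ≈⟨ *-congʳ (Equivalence.from (char2 2) ∣-refl) ⟩
    0# * x               ≈⟨ zeroˡ x ⟩
    0#                   ∎

  -- Tightness reduces the claim to refuting `x # 0#`: an inverse `z` of `x` would give
  -- `y ≈ z * (x * y) ≈ 0#`.
  x*y≈0∧y≉0⇒x≈0 : ∀ {x y} → x * y ≈ 0# → y ≉ 0# → x ≈ 0#
  x*y≈0∧y≉0⇒x≈0 {x} {y} x*y≈0 y≉0 = proj₁ (tight x 0#) λ x#0 →
    let (z , z*[x-0]≈1 , _) = #⇒invertible x#0 in y≉0 (begin
      y                   ≈⟨ *-identityˡ y ⟨
      1# * y              ≈⟨ *-congʳ z*[x-0]≈1 ⟨
      z * (x - 0#) * y    ≈⟨ *-congʳ (*-congˡ (+-congˡ -0#≈0#)) ⟩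
      z * (x + 0#) * y    ≈⟨ *-congʳ (*-congˡ (+-identityʳ x)) ⟩
      z * x * y           ≈⟨ *-assoc z x y ⟩
      z * (x * y)         ≈⟨ *-congˡ x*y≈0 ⟩
      z * 0#              ≈⟨ zeroʳ z ⟩
      0#                  ∎)
    where open RingProperties ring using (-0#≈0#)

  open Characteristic2 R x+x≈0

  module _ {n} (B : Matrix R n) (B-sym : Symmetric R B) where

    open SymmetricMatrix B B-sym

    diagonal≈0 : ∀ {k} → HasLetter R B k N → ∀ α → ∣ α ∣ ≡ suc k →
      principalMinor R B α ≉ 0# → ∀ i → B i i ≈ 0#
    diagonal≈0 {k} letterN α ∣α∣≡1+k α≉0 = go (members α)
      (≡.trans (length-tabulate (elements α)) ∣α∣≡1+k)
      (λ eq → α≉0 (CommutativeRing.trans R (principalMinor≈minor B B-sym α) eq))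
      where
      minors≈0 = minors-vanish B B-sym letterN
      go : ∀ l → length l ≡ suc k → minor l ≉ 0# → ∀ i → B i i ≈ 0#
      go (p ∷ l) eq pl≉0 i = x*y≈0∧y≉0⇒x≈0 (begin
        B i i * minor (p ∷ l)  ≈⟨ diagonal*minor-comm minors≈0 i p l l≡k ⟩
        -- The nonzero minor is cancelled twice: here to get `B p p ≈ 0#`, and at the end of the
        -- chain to get `B i i ≈ 0#`.
        B p p * minor (i ∷ l)  ≈⟨ *-congʳ (x*y≈0∧y≉0⇒x≈0 (diagonal*minor-self minors≈0 p l l≡k) pl≉0) ⟩
        0# * minor (i ∷ l)     ≈⟨ zeroˡ _ ⟩
        0#                     ∎) pl≉0
        where l≡k = ℕ.suc-injective eq

    -- `A` is refuted by any subset of size `j`, and `S` by its own witness.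
    letter-N : (∀ i → B i i ≈ 0#) → ∀ {j} → j ≤ n → Odd j → ∀ x → HasLetter R B j x → x ≡ N
    letter-N diag j≤n odd A allNonzero with subsetOfSize j≤n
    ... | α , ≡.refl = ⊥-elim (allNonzero α ≡.refl (odd-principalMinor≈0 B B-sym diag α odd))
    letter-N diag j≤n odd S ((α , ≡.refl , α≉0) , _) =
      ⊥-elim (α≉0 (odd-principalMinor≈0 B B-sym diag α odd))
    letter-N diag j≤n odd N _ = ≡.refl

    nonzeroMinor : ∀ {j} → j ≤ n → ∀ x → x ≡ A ⊎ x ≡ S → HasLetter R B j x →
      ∃[ α ] ∣ α ∣ ≡ j × principalMinor R B α ≉ 0#
    nonzeroMinor j≤n A _ allNonzero =
      let (α , eq) = subsetOfSize j≤n in α , eq , allNonzero α eq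
    nonzeroMinor j≤n S _ (someNonzero , _) = someNonzero
    nonzeroMinor j≤n N (inj₁ ()) _
    nonzeroMinor j≤n N (inj₂ ()) _

-- Parity and the conclusion

2∣n⇒1+n-odd : 2 ∣ n → Odd (suc n)
2∣n⇒1+n-odd {n} 2∣n 2∣1+n with ∣1⇒≡1 (∣m+n∣m⇒∣n (subst (2 ∣_) (ℕ.+-comm 1 n) 2∣1+n) 2∣n)
... | ()

mainTheorem4 : ∀ {c ℓ₁ ℓ₂} (F : HeytingField c ℓ₁ ℓ₂) → HasCharacteristic (fieldRing F) 2 →
    ∀ (n : ℕ) (B : Matrix (fieldRing F) n) → Symmetric (fieldRing F) B →
    ∀ (ℓs : Vec Letter n) → IsEpr (fieldRing F) B ℓs →
    ∀ (k k′ : Fin n) → position k′ ≡ suc (position k) →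
    (lookup ℓs k ≡ N × lookup ℓs k′ ≡ A) ⊎ (lookup ℓs k ≡ N × lookup ℓs k′ ≡ S) →
    Odd (position k) × (∀ (j : Fin n) → Odd (position j) → lookup ℓs j ≡ N)
mainTheorem4 F char2 n B B-sym ℓs epr k k′ k′≡1+k NAorNS = k-odd , oddLetters
  where
  open Field F char2
  open CommutativeRing R using (_≈_; 0#)

  split : ∀ {x y : Letter} → (x ≡ N × y ≡ A) ⊎ (x ≡ N × y ≡ S) → x ≡ N × (y ≡ A ⊎ y ≡ S)
  split (inj₁ (x≡N , y≡A)) = x≡N , inj₁ y≡A
  split (inj₂ (x≡N , y≡S)) = x≡N , inj₂ y≡S

  letter-k : HasLetter R B (position k) N
  letter-k = subst (HasLetter R B (position k)) (proj₁ (split NAorNS)) (epr k)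

  diag : ∀ i → B i i ≈ 0#
  -- `toℕ<n k′` reads as `position k′ ≤ n`, because positions count from 1.
  diag = let (α , eq , α≉0) = nonzeroMinor B B-sym (toℕ<n k′) _ (proj₂ (split NAorNS)) (epr k′) in
    diagonal≈0 B B-sym letter-k α (≡.trans eq k′≡1+k) α≉0

  oddLetters : ∀ j → Odd (position j) → lookup ℓs j ≡ N
  oddLetters j odd = letter-N B B-sym diag (toℕ<n j) odd _ (epr j)

  k-odd : Odd (position k)
  -- If `position k` were even, `position k′` would be odd and its letter `N`, against `A` or `S`.
  k-odd 2∣k with proj₂ (split NAorNS)
               | oddLetters k′ (subst Odd (≡.sym k′≡1+k) (2∣n⇒1+n-odd 2∣k))
  ... | inj₁ y≡A | y≡N with () ← ≡.trans (≡.sym y≡A) y≡N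
  ... | inj₂ y≡S | y≡N with () ← ≡.trans (≡.sym y≡S) y≡N
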